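{- Suppose $|A|>1$. Then there exists a Hoare-McCarthy algebra $\mathbb{A}^{rp}$ (over the atom set $A$) such that for all closed terms $t,t'\in\mathcal{T}_{\Sigma^A_{ce}}$, $$\mathrm{CP}_{rp}\vdash t=t'\iff \mathbb{A}^{rp}\models t=t'.$$
   Context: Let $A$ be a non-empty, denumerable (finite or countably infinite) set of atoms. $\Sigma^A_{ce}$ is the one-sorted signature with sort $C$ (conditional expressions), constants $T$, $F$ and $a$ (one for each $a\in A$), and a ternary operation $x\triangleleft y\triangleright z$ ("if $y$ then $x$ else $z$"). $\mathcal{T}_{\Sigma^A_{ce}}$ is the set of closed (variable-free) terms over $\Sigma^A_{ce}$. $\mathrm{CP}$ is the set of the four equations (CP1) $x\triangleleft T\triangleright y=x$; (CP2) $x\triangleleft F\triangleright y=y$; (CP3) $T\triangleleft x\triangleright F=x$; (CP4) $x\triangleleft(y\triangleleft z\triangleright u)\triangleright v=(x\triangleleft y\triangleright v)\triangleleft z\triangleright(x\triangleleft u\triangleright v)$. $\mathrm{CP}_{rp}$ is $\mathrm{CP}$ together with, for every $a\in A$, the equations (CPrp1) $(x\triangleleft a\triangleright y)\triangleleft a\triangleright z=(x\triangleleft a\triangleright x)\triangleleft a\triangleright z$; (CPrp2) $x\triangleleft a\triangleright(y\triangleleft a\triangleright z)=x\triangleleft a\triangleright(z\triangleleft a\triangleright z)$. $E\vdash t=t'$ means derivability in equational logic from the set $E$ of equations. A stateful proposition algebra (SPA) is a two-sorted algebra with sorts $C$ and $S$ (states), with the operations of $\Sigma^A_{ce}$ on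 sort $C$, a constant $c$ of sort $S$, and operations $\cdot\triangleleft\cdot\triangleright\cdot:S\times C\times S\to S$, $\bullet:C\times S\to S$ (apply), $!:C\times S\to C$ (reply), satisfying CP on sort $C$ and, for all $x,y,z$ in $C$ and $s,s'$ in $S$ ($\bullet$ and $!$ bind stronger than the conditional): (TS1) $s\triangleleft T\triangleright s'=s$; (TS2) $s\triangleleft F\triangleright s'=s'$; (TS3) if $x\neq T$ and $x\neq F$ then $s\triangleleft x\triangleright s'=c$; (SPA1) $T!s=T$; (SPA2) $F!s=F$; (SPA3) $(x\triangleleft y\triangleright z)!s=x!(y\bullet s)\triangleleft y!s\triangleright z!(y\bullet s)$; (SPA4) $T\bullet s=s$; (SPA5) $F\bullet s=s$; (SPA6) $(x\triangleleft y\triangleright z)\bullet s=x\bullet(y\bullet s)\triangleleft y!s\triangleright z\bullet(y\bullet s)$; (SPA7) $x!s=T$ or $x!s=F$; (SPA8) if $x!s=y!s$ and $x\bullet s=y\bullet s$ for all $s$ in $S$, then $x=y$. A Hoare-McCarthy algebra (HMA) is the $\Sigma^A_{ce}$-reduct of a stateful proposition algebra (i.e. sort $C$ with the operations of $\Sigma^A_{ce}$). -}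

module Defs where

open import Data.Empty using (⊥; ⊥-elim)
open import Data.Fin using (Fin)
open import Data.Nat using (ℕ)
open import Data.Product using (∃; ∃₂; _×_)
open import Data.Sum using (_⊎_)
open import Function.Base using (_∘_)
open import Function.Bundles using (_↔_)
open import Level using (0ℓ)
open import Relation.Binary.Bundles using (Setoid)
open import Relation.Binary.Core using (Rel)
open import Relation.Binary.PropositionalEquality using (_≡_; _≢_)
open import Relation.Nullary using (¬_)

Denumerable : Set → Set
Denumerable A = (∃ λ n → A ↔ Fin n) ⊎ (A ↔ ℕ)

MoreThanOne : Set → Set
MoreThanOne A = ∃₂ λ (a b : A) → a ≢ b

infix 7 _◁_▷_

-- x ◁ y ▷ z is "if y then x else z".
data Term (A V : Set) : Set where
  var   : V → Term A V
  T F   : Term A V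
  atom  : A → Term A V
  _◁_▷_ : (x y z : Term A V) → Term A V

OpenTerm : Set → Set
OpenTerm A = Term A ℕ

ClosedTerm : Set → Set
ClosedTerm A = Term A ⊥

_[_] : ∀ {A V W} → Term A V → (V → Term A W) → Term A W
var v       [ σ ] = σ v
T           [ σ ] = T
F           [ σ ] = F
atom a      [ σ ] = atom a
(x ◁ y ▷ z) [ σ ] = (x [ σ ]) ◁ (y [ σ ]) ▷ (z [ σ ])

⌜_⌝ : ∀ {A} → ClosedTerm A → OpenTerm A
⌜ t ⌝ = t [ var ∘ ⊥-elim ]

-- A set of equations is given as the relation of its (left, right) pairs.
Equations : Set → Set₁
Equations A = Rel (OpenTerm A) 0ℓ

module _ {A : Set} where

  private
    x y z u v : OpenTerm A
    x = var 0
    y = var 1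
    z = var 2
    u = var 3
    v = var 4

  data CP : Equations A where
    CP1 : CP (x ◁ T ▷ y) x
    CP2 : CP (x ◁ F ▷ y) y
    CP3 : CP (T ◁ x ▷ F) x
    CP4 : CP (x ◁ (y ◁ z ▷ u) ▷ v) ((x ◁ y ▷ v) ◁ z ▷ (x ◁ u ▷ v))

  data CPrp : Equations A where
    cp    : ∀ {l r} → CP l r → CPrp l r
    CPrp1 : ∀ a → CPrp ((x ◁ atom a ▷ y) ◁ atom a ▷ z)
                       ((x ◁ atom a ▷ x) ◁ atom a ▷ z)
    CPrp2 : ∀ a → CPrp (x ◁ atom a ▷ (y ◁ atom a ▷ z))
                       (x ◁ atom a ▷ (z ◁ atom a ▷ z))

infix 4 _⊢_≐_

data _⊢_≐_ {A : Set} (E : Equations A) : OpenTerm A → OpenTerm A → Set where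
  axiom      : ∀ {t t′} → E t t′ → E ⊢ t ≐ t′
  reflexive  : ∀ {t} → E ⊢ t ≐ t
  symmetric  : ∀ {t t′} → E ⊢ t ≐ t′ → E ⊢ t′ ≐ t
  transitive : ∀ {t t′ t″} → E ⊢ t ≐ t′ → E ⊢ t′ ≐ t″ → E ⊢ t ≐ t″
  congruence : ∀ {x x′ y y′ z z′} →
               E ⊢ x ≐ x′ → E ⊢ y ≐ y′ → E ⊢ z ≐ z′ →
               E ⊢ x ◁ y ▷ z ≐ x′ ◁ y′ ▷ z′
  substitute : ∀ {t t′} (σ : ℕ → OpenTerm A) →
               E ⊢ t ≐ t′ → E ⊢ t [ σ ] ≐ t′ [ σ ]

-- Carriers are setoids, whose equality is the equality of the algebra: the
-- algebras of interest are quotients of term algebras.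
record CEAlgebra (A : Set) : Set₁ where
  field
    C : Setoid 0ℓ 0ℓ

  open Setoid C public using (_≈_) renaming (Carrier to ∣C∣)

  field
    Tᶜ Fᶜ  : ∣C∣
    atomᶜ  : A → ∣C∣
    condᶜ  : ∣C∣ → ∣C∣ → ∣C∣ → ∣C∣
    condᶜ-cong : ∀ {x x′ y y′ z z′} → x ≈ x′ → y ≈ y′ → z ≈ z′ →
                 condᶜ x y z ≈ condᶜ x′ y′ z′

  ⟦_⟧ : OpenTerm A → (ℕ → ∣C∣) → ∣C∣
  ⟦ var v ⟧     ρ = ρ v
  ⟦ T ⟧         ρ = Tᶜ
  ⟦ F ⟧         ρ = Fᶜ
  ⟦ atom a ⟧    ρ = atomᶜ a
  ⟦ x ◁ y ▷ z ⟧ ρ = condᶜ (⟦ x ⟧ ρ) (⟦ y ⟧ ρ) (⟦ z ⟧ ρ)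

infix 4 _⊨_≐_

_⊨_≐_ : ∀ {A} → CEAlgebra A → OpenTerm A → OpenTerm A → Set
𝔸 ⊨ t ≐ t′ = ∀ ρ → ⟦ t ⟧ ρ ≈ ⟦ t′ ⟧ ρ
  where open CEAlgebra 𝔸

record SPA (A : Set) : Set₁ where
  infixr 8 _•_
  infix  8 _!_
  infix  7 _◂ˢ_▸_

  field
    reduct : CEAlgebra A
    S      : Setoid 0ℓ 0ℓ

  open CEAlgebra reduct public renaming (condᶜ to infix 7 _◂_▸_)
  open Setoid S public using () renaming (Carrier to ∣S∣; _≈_ to infix 4 _≈ˢ_)

  field
    c       : ∣S∣
    _◂ˢ_▸_  : ∣S∣ → ∣C∣ → ∣S∣ → ∣S∣
    _•_     : ∣C∣ → ∣S∣ → ∣S∣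
    _!_     : ∣C∣ → ∣S∣ → ∣C∣

    condˢ-cong : ∀ {s s′ x x′ r r′} → s ≈ˢ s′ → x ≈ x′ → r ≈ˢ r′ →
                 s ◂ˢ x ▸ r ≈ˢ s′ ◂ˢ x′ ▸ r′
    •-cong     : ∀ {x x′ s s′} → x ≈ x′ → s ≈ˢ s′ → x • s ≈ˢ x′ • s′
    !-cong     : ∀ {x x′ s s′} → x ≈ x′ → s ≈ˢ s′ → x ! s ≈ x′ ! s′

    satisfiesCP : ∀ {l r} → CP l r → reduct ⊨ l ≐ r

    TS1 : ∀ s s′ → s ◂ˢ Tᶜ ▸ s′ ≈ˢ s
    TS2 : ∀ s s′ → s ◂ˢ Fᶜ ▸ s′ ≈ˢ s′
    TS3 : ∀ x s s′ → ¬ (x ≈ Tᶜ) → ¬ (x ≈ Fᶜ) → s ◂ˢ x ▸ s′ ≈ˢ c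

    SPA1 : ∀ s → Tᶜ ! s ≈ Tᶜ
    SPA2 : ∀ s → Fᶜ ! s ≈ Fᶜ
    SPA3 : ∀ x y z s →
           (x ◂ y ▸ z) ! s ≈ (x ! (y • s)) ◂ (y ! s) ▸ (z ! (y • s))
    SPA4 : ∀ s → Tᶜ • s ≈ˢ s
    SPA5 : ∀ s → Fᶜ • s ≈ˢ s
    SPA6 : ∀ x y z s →
           (x ◂ y ▸ z) • s ≈ˢ (x • (y • s)) ◂ˢ (y ! s) ▸ (z • (y • s))
    SPA7 : ∀ x s → (x ! s ≈ Tᶜ) ⊎ (x ! s ≈ Fᶜ)
    SPA8 : ∀ x y → (∀ s → (x ! s ≈ y ! s) × (x • s ≈ˢ y • s)) → x ≈ y

IsHMA : ∀ {A} → CEAlgebra A → Set₁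
IsHMA {A} 𝔸 = ∃ λ (𝔹 : SPA A) → SPA.reduct 𝔹 ≡ 𝔸

{-# OPTIONS --safe #-}

-- A state records the answered queries and a queue of replies to come; an atom
-- asked twice in a row repeats its reply, any other query consumes the queue.
-- Closed terms act on states as decision trees, and two trees are identified
-- when they act alike.  Since the history names every atom that was asked, and
-- the queue can supply any reply to a query that is not a repetition, trees
-- that act alike agree except in the branches that repetition makes
-- unreachable, and these are exchanged by CPrp1 and CPrp2.
module Submission where

open import Defs
open import Data.Bool.Base using (Bool; true; false; if_then_else_)
open import Data.Fin.Properties using () renaming (_≟_ to _≟ᶠ_)
open import Data.List.Base using (List; []; _∷_; _++_; _∷ʳ_)
open import Data.List.Properties using (∷ʳ-++; ∷ʳ-injectiveʳ; ++-cancelʳ)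
open import Data.Nat.Base using (ℕ; zero; suc)
open import Data.Nat.Properties using () renaming (_≟_ to _≟ⁿ_)
open import Data.Product using (∃; _×_; _,_; proj₁; proj₂)
open import Data.Sum using (_⊎_; inj₁; inj₂)
open import Function.Base using (_∘_; id)
open import Function.Bundles using (_⇔_; mk⇔)
open import Function.Properties.Inverse using (↔⇒↣)
open import Level using (0ℓ)
open import Relation.Binary.Bundles using (Setoid)
open import Relation.Binary.Definitions using (DecidableEquality)
open import Relation.Binary.PropositionalEquality
  using (_≡_; _≢_; refl; sym; trans; cong; cong₂; setoid)
open import Relation.Nullary using (Dec; ¬_; yes; no; contradiction)
open import Relation.Nullary.Decidable using (via-injection)
import Relation.Binary.Reasoning.Setoid as SetoidReasoning

-- Equality is decided in `Fin n` or `ℕ` and pulled back along the injection; `ask` needs it to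
-- recognise a repeated atom.
denumerable⇒≟ : ∀ {A} → Denumerable A → DecidableEquality A
denumerable⇒≟ (inj₁ (_ , A↔Fin)) = via-injection (↔⇒↣ A↔Fin) _≟ᶠ_
denumerable⇒≟ (inj₂ A↔ℕ)         = via-injection (↔⇒↣ A↔ℕ) _≟ⁿ_

-- Soundness of equational derivations

module _ {A : Set} (E : Equations A) where

  ⊢-setoid : Setoid 0ℓ 0ℓ
  ⊢-setoid = record
    { Carrier       = OpenTerm A
    ; _≈_           = E ⊢_≐_
    ; isEquivalence = record
      { refl = reflexive ; sym = symmetric ; trans = transitive }
    }

module _ {A : Set} (𝔸 : CEAlgebra A) where
  open CEAlgebra 𝔸
  private module ≈ = Setoid C

  ⟦⟧-[] : ∀ t σ ρ → ⟦ t [ σ ] ⟧ ρ ≈ ⟦ t ⟧ (λ v → ⟦ σ v ⟧ ρ)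
  ⟦⟧-[] (var v)     σ ρ = ≈.refl
  ⟦⟧-[] T           σ ρ = ≈.refl
  ⟦⟧-[] F           σ ρ = ≈.refl
  ⟦⟧-[] (atom a)    σ ρ = ≈.refl
  ⟦⟧-[] (x ◁ y ▷ z) σ ρ =
    condᶜ-cong (⟦⟧-[] x σ ρ) (⟦⟧-[] y σ ρ) (⟦⟧-[] z σ ρ)

  soundness : ∀ {E : Equations A} → (∀ {l r} → E l r → 𝔸 ⊨ l ≐ r) →
              ∀ {t t′} → E ⊢ t ≐ t′ → 𝔸 ⊨ t ≐ t′
  soundness ax (axiom e)            ρ = ax e ρ
  soundness ax reflexive            ρ = ≈.refl
  soundness ax (symmetric d)        ρ = ≈.sym (soundness ax d ρ)
  soundness ax (transitive d e)     ρ = ≈.trans (soundness ax d ρ) (soundness ax e ρ)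
  soundness ax (congruence d e f)   ρ =
    condᶜ-cong (soundness ax d ρ) (soundness ax e ρ) (soundness ax f ρ)
  soundness ax (substitute {t} {t′} σ d) ρ =
    ≈.trans (⟦⟧-[] t σ ρ)
      (≈.trans (soundness ax d (λ v → ⟦ σ v ⟧ ρ)) (≈.sym (⟦⟧-[] t′ σ ρ)))

-- Decision trees as normal forms of closed terms

data Tree (A : Set) : Set where
  leaf : Bool → Tree A
  node : A → (l r : Tree A) → Tree A

-- Latest query first.
History : Set → Set
History A = List (A × Bool)

State : Set → Set
State A = History A × List Bool

history : ∀ {A} → Bool × State A → History A
history = proj₁ ∘ proj₂

next : List Bool → Bool × List Bool
-- The default reply of an exhausted queue keeps every run total.
next []      = false , []
next (b ∷ q) = b , q

module _ {A : Set} where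

  cond : Tree A → Tree A → Tree A → Tree A
  cond x (leaf b)     z = if b then x else z
  cond x (node a l r) z = node a (cond x l z) (cond x r z)

  query : A → Tree A
  query a = node a (leaf true) (leaf false)

  cond-identityʳ : ∀ x → cond (leaf true) x (leaf false) ≡ x
  cond-identityʳ (leaf true)  = refl
  cond-identityʳ (leaf false) = refl
  cond-identityʳ (node a l r) = cong₂ (node a) (cond-identityʳ l) (cond-identityʳ r)

  cond-assoc : ∀ x y z u v →
    cond x (cond y z u) v ≡ cond (cond x y v) z (cond x u v)
  cond-assoc x y (leaf true)  u v = refl
  cond-assoc x y (leaf false) u v = refl
  cond-assoc x y (node a l r) u v =
    cong₂ (node a) (cond-assoc x y l u v) (cond-assoc x y r u v)

  toTerm : Tree A → OpenTerm A
  toTerm (leaf true)  = T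
  toTerm (leaf false) = F
  toTerm (node a l r) = toTerm l ◁ atom a ▷ toTerm r

  tree : ClosedTerm A → Tree A
  tree T           = leaf true
  tree F           = leaf false
  tree (atom a)    = query a
  tree (x ◁ y ▷ z) = cond (tree x) (tree y) (tree z)

  assign : List (OpenTerm A) → ℕ → OpenTerm A
  assign []       _       = T
  assign (t ∷ ts) zero    = t
  assign (t ∷ ts) (suc n) = assign ts n

  instantiate : ∀ {E : Equations A} {l r} ts → E l r →
                E ⊢ l [ assign ts ] ≐ r [ assign ts ]
  instantiate ts e = substitute (assign ts) (axiom e)

  -- Induction on the condition: CP4 moves its root atom outward, leaving conditionals over the two
  -- subtrees, and CP1 and CP2 settle the leaves.
  ⊢-cond : ∀ x y z → CPrp ⊢ toTerm x ◁ toTerm y ▷ toTerm z ≐ toTerm (cond x y z)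
  ⊢-cond x (leaf true)  z = instantiate (toTerm x ∷ toTerm z ∷ []) (cp CP1)
  ⊢-cond x (leaf false) z = instantiate (toTerm x ∷ toTerm z ∷ []) (cp CP2)
  ⊢-cond x (node a l r) z = transitive
    (instantiate (toTerm x ∷ toTerm l ∷ atom a ∷ toTerm r ∷ toTerm z ∷ []) (cp CP4))
    (congruence (⊢-cond x l z) reflexive (⊢-cond x r z))

  ⊢-tree : ∀ t → CPrp ⊢ ⌜ t ⌝ ≐ toTerm (tree t)
  ⊢-tree T           = reflexive
  ⊢-tree F           = reflexive
  ⊢-tree (atom a)    = symmetric (instantiate (atom a ∷ []) (cp CP3))
  ⊢-tree (x ◁ y ▷ z) = transitive
    (congruence (⊢-tree x) (⊢-tree y) (⊢-tree z))
    (⊢-cond (tree x) (tree y) (tree z))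

  -- Provability relative to a history

  -- Provability of x ≐ y in a place reached by the queries in the history; by
  -- the repetition-proof axioms only the latest query matters.
  After : History A → OpenTerm A → OpenTerm A → Set
  After []              x y = CPrp ⊢ x ≐ y
  After ((a , true) ∷ _)  x y = ∀ z → CPrp ⊢ x ◁ atom a ▷ z ≐ y ◁ atom a ▷ z
  After ((a , false) ∷ _) x y = ∀ z → CPrp ⊢ z ◁ atom a ▷ x ≐ z ◁ atom a ▷ y

  ⊢⇒After : ∀ h {x y} → CPrp ⊢ x ≐ y → After h x y
  ⊢⇒After []                d   = d
  ⊢⇒After ((a , true) ∷ _)  d z = congruence d reflexive reflexive
  ⊢⇒After ((a , false) ∷ _) d z = congruence reflexive reflexive d

  -- The branches are replaced one at a time, the quantified sibling being what stands there at that
  -- moment: first `r`, then `l′`.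
  After-node : ∀ {h h′ a l l′ r r′} →
    After ((a , true) ∷ h) l l′ → After ((a , false) ∷ h′) r r′ →
    CPrp ⊢ l ◁ atom a ▷ r ≐ l′ ◁ atom a ▷ r′
  After-node {l′ = l′} {r} d e = transitive (d r) (e l′)

  -- Once `a` has answered `true`, the inner `false` branch is out of reach: CPrp1 replaces both `r`
  -- and `r′` by `l′`, so they may be unrelated.
  After-repeat-true : ∀ {h h′ a l l′} r r′ → After ((a , true) ∷ h) l l′ →
    After ((a , true) ∷ h′) (l ◁ atom a ▷ r) (l′ ◁ atom a ▷ r′)
  After-repeat-true {a = a} {l} {l′} r r′ d z = begin
    (l ◁ atom a ▷ r) ◁ atom a ▷ z    ≈⟨ congruence (d r) reflexive reflexive ⟩
    (l′ ◁ atom a ▷ r) ◁ atom a ▷ z   ≈⟨ instantiate (l′ ∷ r ∷ z ∷ []) (CPrp1 a) ⟩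
    (l′ ◁ atom a ▷ l′) ◁ atom a ▷ z  ≈⟨ instantiate (l′ ∷ r′ ∷ z ∷ []) (CPrp1 a) ⟨
    (l′ ◁ atom a ▷ r′) ◁ atom a ▷ z  ∎
    where open SetoidReasoning (⊢-setoid CPrp)

  After-repeat-false : ∀ {h h′ a r r′} l l′ → After ((a , false) ∷ h) r r′ →
    After ((a , false) ∷ h′) (l ◁ atom a ▷ r) (l′ ◁ atom a ▷ r′)
  After-repeat-false {a = a} {r} {r′} l l′ d z = begin
    z ◁ atom a ▷ (l ◁ atom a ▷ r)    ≈⟨ congruence reflexive reflexive (d l) ⟩
    z ◁ atom a ▷ (l ◁ atom a ▷ r′)   ≈⟨ instantiate (z ∷ l ∷ r′ ∷ []) (CPrp2 a) ⟩
    z ◁ atom a ▷ (r′ ◁ atom a ▷ r′)  ≈⟨ instantiate (z ∷ l′ ∷ r′ ∷ []) (CPrp2 a) ⟨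
    z ◁ atom a ▷ (l′ ◁ atom a ▷ r′)  ∎
    where open SetoidReasoning (⊢-setoid CPrp)

-- Running trees on states

module Repetition {A : Set} (_≟_ : DecidableEquality A) where

  ask : A → History A → List Bool → Bool × List Bool
  ask a []            q = next q
  ask a ((c , b) ∷ h) q with a ≟ c
  ... | yes _ = b , q
  ... | no  _ = next q

  run : Tree A → State A → Bool × State A
  run (leaf b)     s       = b , s
  run (node a l r) (h , q) with ask a h q
  ... | true  , q′ = run l ((a , true) ∷ h , q′)
  ... | false , q′ = run r ((a , false) ∷ h , q′)

  ask-repeat : ∀ a b h q → ask a ((a , b) ∷ h) q ≡ (b , q)
  ask-repeat a b h q with a ≟ a
  ... | yes _  = refl
  ... | no a≢a = contradiction refl a≢a

  ask-other : ∀ {a c} b h q → a ≢ c → ask a ((c , b) ∷ h) q ≡ next q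
  ask-other {a} {c} b h q a≢c with a ≟ c
  ... | yes a≡c = contradiction a≡c a≢c
  ... | no  _   = refl

  run-node : ∀ {b q′} a l r h q → ask a h q ≡ (b , q′) →
    run (node a l r) (h , q) ≡ run (if b then l else r) ((a , b) ∷ h , q′)
  run-node {true}  a l r h q eq rewrite eq = refl
  run-node {false} a l r h q eq rewrite eq = refl

  run-repeat : ∀ a b l r h q → run (node a l r) ((a , b) ∷ h , q) ≡
    run (if b then l else r) ((a , b) ∷ (a , b) ∷ h , q)
  run-repeat a b l r h q = run-node a l r ((a , b) ∷ h) q (ask-repeat a b h q)

  -- A conditional is sequential composition: the chosen branch starts in the state that the
  -- condition leaves. SPA3, SPA6 and the congruence of `cond` rest on this.
  run-cond : ∀ x y z s → run (cond x y z) s ≡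
    run (if proj₁ (run y s) then x else z) (proj₂ (run y s))
  run-cond x (leaf b)     z s       = refl
  run-cond x (node a l r) z (h , q) with ask a h q
  ... | true  , q′ = run-cond x l z _
  ... | false , q′ = run-cond x r z _

  -- What the final history reveals about a tree

  run-extends : ∀ t s → ∃ λ e → history (run t s) ≡ e ++ proj₁ s
  -- New entries go in front, so the root's query, made first, ends up next to the old history, as
  -- the last of the added entries.
  run-node-extends : ∀ a l r s →
    ∃ λ e → ∃ λ b → history (run (node a l r) s) ≡ (e ∷ʳ (a , b)) ++ proj₁ s

  run-extends (leaf b)     s = [] , refl
  run-extends (node a l r) s = let e , b , eq = run-node-extends a l r s in
    e ∷ʳ (a , b) , eq

  run-node-extends a l r (h , q) with ask a h q
  ... | true  , q′ = let e , eq = run-extends l ((a , true) ∷ h , q′) in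
    e , true , trans eq (sym (∷ʳ-++ e _ h))
  ... | false , q′ = let e , eq = run-extends r ((a , false) ∷ h , q′) in
    e , false , trans eq (sym (∷ʳ-++ e _ h))

  leaf≢node : ∀ {b a} l r s → run (leaf b) s ≢ run (node a l r) s
  leaf≢node {a = a} l r (h , q) eq =
    let e , b , ext = run-node-extends a l r (h , q)
    in ∷ʳ≢[] e (++-cancelʳ h [] (e ∷ʳ (a , b)) (trans (cong history eq) ext))
    where
    ∷ʳ≢[] : ∀ {x : A × Bool} xs → [] ≢ xs ∷ʳ x
    ∷ʳ≢[] []       ()
    ∷ʳ≢[] (_ ∷ xs) ()

  -- Cancelling the old history leaves one list of new queries for both trees, and its oldest entry
  -- names the root of each.
  root-unique : ∀ {a l r a′ l′ r′} s →
    run (node a l r) s ≡ run (node a′ l′ r′) s → a ≡ a′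
  root-unique {a} {l} {r} {a′} {l′} {r′} s@(h , _) eq =
    let e  , b  , ext  = run-node-extends a l r s
        e′ , b′ , ext′ = run-node-extends a′ l′ r′ s
        e∷ʳ≡e′∷ʳ       = ++-cancelʳ h (e ∷ʳ (a , b)) (e′ ∷ʳ (a′ , b′))
                           (trans (sym ext) (trans (cong history eq) ext′))
    in cong proj₁ (∷ʳ-injectiveʳ e e′ e∷ʳ≡e′∷ʳ)

  -- Trees that act alike are provably equal

  ActAlikeAfter : History A → Tree A → Tree A → Set
  ActAlikeAfter h x y = ∀ q → run x (h , q) ≡ run y (h , q)

  -- `f` chooses the queue for the node so that `a` is answered by `b` and the branch then sees
  -- exactly `q`: it prepends `b` for a fresh query and is the identity for a repeated one.
  actAlike-branch : ∀ a b h l r l′ r′ (f : List Bool → List Bool) →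
    (∀ q → ask a h (f q) ≡ (b , q)) →
    ActAlikeAfter h (node a l r) (node a l′ r′) →
    ActAlikeAfter ((a , b) ∷ h) (if b then l else r) (if b then l′ else r′)
  actAlike-branch a b h l r l′ r′ f reply x≈y q =
    trans (sym (run-node a l r h (f q) (reply q)))
      (trans (x≈y (f q)) (run-node a l′ r′ h (f q) (reply q)))

  -- Induction on the trees, with a history that grows on the way down. Root atoms agree because
  -- histories do. After a fresh query both pairs of branches can be tested by a suitable queue;
  -- after a repeated one, only the pair selected by the remembered reply.
  completeness : ∀ x y h → ActAlikeAfter h x y → After h (toTerm x) (toTerm y)
  completeness (leaf b) (leaf b′) h x≈y with cong proj₁ (x≈y [])
  ... | refl = ⊢⇒After h reflexive
  completeness (leaf b) (node a l r) h x≈y =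
    contradiction (x≈y []) (leaf≢node l r (h , []))
  completeness (node a l r) (leaf b) h x≈y =
    contradiction (sym (x≈y [])) (leaf≢node l r (h , []))
  completeness (node a l r) (node a′ l′ r′) h x≈y
    with root-unique {a} {l} {r} {a′} {l′} {r′} (h , []) (x≈y [])
  ... | refl = go h x≈y
    where
    fresh : ∀ h → (∀ q → ask a h q ≡ next q) →
            ActAlikeAfter h (node a l r) (node a l′ r′) →
            After h (toTerm (node a l r)) (toTerm (node a l′ r′))
    fresh h reply eq = ⊢⇒After h (After-node {h = h} {h′ = h}
      (completeness l l′ _
        (actAlike-branch a true h l r l′ r′ (true ∷_) (λ q → reply (true ∷ q)) eq))
      (completeness r r′ _
        (actAlike-branch a false h l r l′ r′ (false ∷_) (λ q → reply (false ∷ q)) eq)))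

    asked : ∀ c b h → Dec (a ≡ c) →
            ActAlikeAfter ((c , b) ∷ h) (node a l r) (node a l′ r′) →
            After ((c , b) ∷ h) (toTerm (node a l r)) (toTerm (node a l′ r′))
    asked c b     h (no a≢c)   eq = fresh _ (λ q → ask-other b h q a≢c) eq
    -- Runs say nothing about the `false` branches here; CPrp1 takes care of them.
    asked c true  h (yes refl) eq = After-repeat-true {h = h} {h′ = h} _ _
      (completeness l l′ _
        (actAlike-branch a true ((a , true) ∷ h) l r l′ r′ id (ask-repeat a true h) eq))
    asked c false h (yes refl) eq = After-repeat-false {h = h} {h′ = h} _ _
      (completeness r r′ _
        (actAlike-branch a false ((a , false) ∷ h) l r l′ r′ id (ask-repeat a false h) eq))

    go : ∀ h → ActAlikeAfter h (node a l r) (node a l′ r′) →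
         After h (toTerm (node a l r)) (toTerm (node a l′ r′))
    go []            eq = fresh [] (λ _ → refl) eq
    go ((c , b) ∷ h) eq = asked c b h (a ≟ c) eq

  -- The algebra of trees up to equal action

  𝔸ʳᵖ : CEAlgebra A
  𝔸ʳᵖ = record
    { C = record
      { Carrier       = Tree A
      -- Reply and final state are compared together, which is what SPA8 can observe.
      ; _≈_           = λ x y → ∀ s → run x s ≡ run y s
      ; isEquivalence = record
        { refl  = λ _ → refl
        ; sym   = λ x≈y s → sym (x≈y s)
        ; trans = λ x≈y y≈z s → trans (x≈y s) (y≈z s)
        }
      }
    ; Tᶜ         = leaf true
    ; Fᶜ         = leaf false
    ; atomᶜ      = query
    ; condᶜ      = cond
    ; condᶜ-cong = λ {x} {x′} {y} {y′} {z} {z′} → cond-cong {x} {x′} {y} {y′} {z} {z′}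
    }
    where
    cond-cong : ∀ {x x′ y y′ z z′ : Tree A} →
      (∀ s → run x s ≡ run x′ s) → (∀ s → run y s ≡ run y′ s) →
      (∀ s → run z s ≡ run z′ s) →
      ∀ s → run (cond x y z) s ≡ run (cond x′ y′ z′) s
    cond-cong {x} {x′} {y} {y′} {z} {z′} x≈x′ y≈y′ z≈z′ s
      rewrite run-cond x y z s | run-cond x′ y′ z′ s | y≈y′ s
      with run y′ s
    ... | true  , s′ = x≈x′ s′
    ... | false , s′ = z≈z′ s′

  open CEAlgebra 𝔸ʳᵖ using (_≈_; ⟦_⟧)

  𝔸ʳᵖ-CP : ∀ {l r} → CP l r → 𝔸ʳᵖ ⊨ l ≐ r
  𝔸ʳᵖ-CP CP1 ρ s = refl
  𝔸ʳᵖ-CP CP2 ρ s = refl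
  𝔸ʳᵖ-CP CP3 ρ s = cong (λ t → run t s) (cond-identityʳ (ρ 0))
  𝔸ʳᵖ-CP CP4 ρ s =
    cong (λ t → run t s) (cond-assoc (ρ 0) (ρ 1) (ρ 2) (ρ 3) (ρ 4))

  -- A nested query that directly follows the same atom repeats its reply, so the branch in which
  -- the two sides differ is never entered.
  𝔸ʳᵖ-CPrp : ∀ {l r} → CPrp l r → 𝔸ʳᵖ ⊨ l ≐ r
  𝔸ʳᵖ-CPrp (cp e) = 𝔸ʳᵖ-CP e
  𝔸ʳᵖ-CPrp (CPrp1 a) ρ (h , q) with ask a h q
  ... | false , q′ = refl
  ... | true  , q′ = trans (run-repeat a true (ρ 0) (ρ 1) h q′)
    (sym (run-repeat a true (ρ 0) (ρ 0) h q′))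
  𝔸ʳᵖ-CPrp (CPrp2 a) ρ (h , q) with ask a h q
  ... | true  , q′ = refl
  ... | false , q′ = trans (run-repeat a false (ρ 1) (ρ 2) h q′)
    (sym (run-repeat a false (ρ 2) (ρ 2) h q′))

  -- The stateful proposition algebra

  select : State A → Tree A → State A → State A
  select s (leaf b)     s′ = if b then s else s′
  select s (node _ _ _) s′ = [] , []

  -- Matching on the shape of the tree respects `≈`: in the empty state the reply separates the two
  -- leaves, and the history separates a leaf from a node. Hence the trees equal to `T` or `F` are
  -- exactly the leaves, as TS3 requires.
  select-congˣ : ∀ {s s′} x x′ → x ≈ x′ → select s x s′ ≡ select s x′ s′
  select-congˣ (leaf b)     (leaf b′)       x≈x′ with cong proj₁ (x≈x′ ([] , []))
  ... | refl = refl
  select-congˣ (leaf b)     (node a l r)    x≈x′ =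
    contradiction (x≈x′ _) (leaf≢node l r ([] , []))
  select-congˣ (node a l r) (leaf b)        x≈x′ =
    contradiction (sym (x≈x′ _)) (leaf≢node l r ([] , []))
  select-congˣ (node _ _ _) (node _ _ _)    x≈x′ = refl

  select-undefined : ∀ x s s′ → ¬ (x ≈ leaf true) → ¬ (x ≈ leaf false) →
                     select s x s′ ≡ ([] , [])
  select-undefined (leaf true)  s s′ x≉T x≉F = contradiction (λ _ → refl) x≉T
  select-undefined (leaf false) s s′ x≉T x≉F = contradiction (λ _ → refl) x≉F
  select-undefined (node _ _ _) s s′ x≉T x≉F = refl

  apply : Tree A → State A → State A
  apply x s = proj₂ (run x s)

  reply : Tree A → State A → Tree A
  reply x s = leaf (proj₁ (run x s))

  reply-cond : ∀ x y z s →
    reply (cond x y z) s ≈ cond (reply x (apply y s)) (reply y s) (reply z (apply y s))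
  reply-cond x y z s _ rewrite run-cond x y z s with proj₁ (run y s)
  ... | true  = refl
  ... | false = refl

  apply-cond : ∀ x y z s →
    apply (cond x y z) s ≡ select (apply x (apply y s)) (reply y s) (apply z (apply y s))
  apply-cond x y z s = trans (cong proj₂ (run-cond x y z s)) (branch (proj₁ (run y s)))
    where
    s′ = apply y s

    branch : ∀ b → apply (if b then x else z) s′ ≡ select (apply x s′) (leaf b) (apply z s′)
    branch true  = refl
    branch false = refl

  reply-two-valued : ∀ x s → (reply x s ≈ leaf true) ⊎ (reply x s ≈ leaf false)
  reply-two-valued x s with proj₁ (run x s)
  ... | true  = inj₁ λ _ → refl
  ... | false = inj₂ λ _ → refl

  spaʳᵖ : SPA A
  spaʳᵖ = record
    { reduct      = 𝔸ʳᵖ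
    ; S           = setoid (State A)
    ; c           = [] , []
    ; _◂ˢ_▸_      = select
    ; _•_         = apply
    ; _!_         = reply
    ; condˢ-cong  = λ { {x = x} {x′ = x′} refl x≈x′ refl → select-congˣ x x′ x≈x′ }
    ; •-cong      = λ { {s = s} x≈x′ refl → cong proj₂ (x≈x′ s) }
    ; !-cong      = λ { {s = s} x≈x′ refl r → cong (λ p → proj₁ p , r) (x≈x′ s) }
    ; satisfiesCP = 𝔸ʳᵖ-CP
    ; TS1         = λ _ _ → refl
    ; TS2         = λ _ _ → refl
    ; TS3         = select-undefined
    ; SPA1        = λ _ _ → refl
    ; SPA2        = λ _ _ → refl
    ; SPA3        = reply-cond
    ; SPA4        = λ _ → refl
    ; SPA5        = λ _ → refl
    ; SPA6        = apply-cond
    ; SPA7        = reply-two-valued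
    -- Replies are leaves, so running them in any state, here `s`, returns their Booleans.
    ; SPA8        = λ x y eq s →
        cong₂ _,_ (cong proj₁ (proj₁ (eq s) s)) (proj₂ (eq s))
    }

  -- Closed terms and the equivalence

  ⟦⌜⌝⟧ : ∀ t ρ → ⟦ ⌜ t ⌝ ⟧ ρ ≡ tree t
  ⟦⌜⌝⟧ T           ρ = refl
  ⟦⌜⌝⟧ F           ρ = refl
  ⟦⌜⌝⟧ (atom a)    ρ = refl
  ⟦⌜⌝⟧ (x ◁ y ▷ z) ρ
    rewrite ⟦⌜⌝⟧ x ρ | ⟦⌜⌝⟧ y ρ | ⟦⌜⌝⟧ z ρ = refl

  ⊨⇒⊢ : ∀ t t′ → 𝔸ʳᵖ ⊨ ⌜ t ⌝ ≐ ⌜ t′ ⌝ → CPrp ⊢ ⌜ t ⌝ ≐ ⌜ t′ ⌝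
  ⊨⇒⊢ t t′ valid = begin
    ⌜ t ⌝             ≈⟨ ⊢-tree t ⟩
    -- At the empty history `After` is plain provability.
    toTerm (tree t)   ≈⟨ completeness (tree t) (tree t′) [] tree-≈ ⟩
    toTerm (tree t′)  ≈⟨ ⊢-tree t′ ⟨
    ⌜ t′ ⌝            ∎
    where
    open SetoidReasoning (⊢-setoid CPrp)

    -- The value of a closed term does not depend on the valuation, so a constant one serves.
    ρ : ℕ → Tree A
    ρ _ = leaf true

    tree-≈ : ActAlikeAfter [] (tree t) (tree t′)
    tree-≈ q = trans (cong (λ x → run x ([] , q)) (sym (⟦⌜⌝⟧ t ρ)))
      (trans (valid ρ ([] , q)) (cong (λ x → run x ([] , q)) (⟦⌜⌝⟧ t′ ρ)))

theorem4 : ∀ {A : Set} → Denumerable A → MoreThanOne A →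
    ∃ λ (𝔸 : CEAlgebra A) → IsHMA 𝔸 ×
    (∀ (t t′ : ClosedTerm A) → (CPrp ⊢ ⌜ t ⌝ ≐ ⌜ t′ ⌝) ⇔ (𝔸 ⊨ ⌜ t ⌝ ≐ ⌜ t′ ⌝))
theorem4 denumerable _ =
  𝔸ʳᵖ , (spaʳᵖ , refl) , λ t t′ → mk⇔ (soundness 𝔸ʳᵖ 𝔸ʳᵖ-CPrp) (⊨⇒⊢ t t′)
  where open Repetition (denumerable⇒≟ denumerable)
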